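{- Let $a,b,c$ and $M$ be integers with $M \geq 1$ satisfying $1<a<b<c$ and $1+c=a+b$. If $a \nmid b$, then for every integer $L \geq 0$, $$\frac{1}{(q,q^c;q^M)_L} - \frac{1}{(q^a,q^b;q^M)_L} \succeq 0.$$
   Context: Notation: $(x;q)_n := \prod_{j=0}^{n-1}(1-xq^j)$ and $(x_1,\dots,x_r;q)_n := (x_1;q)_n\cdots(x_r;q)_n$, with empty products equal to $1$; thus $(q^s,q^t;q^M)_L=\prod_{j=0}^{L-1}(1-q^{Mj+s})(1-q^{Mj+t})$. Quotients are expanded as formal power series in $q$. For a power series $f(q)=\sum_{n\ge 0}a_nq^n$, $f(q)\succeq 0$ means $a_n \geq 0$ for all $n$. It is not assumed that $a,b,c \leq M$. -}

module Defs where

open import Level using (0ℓ)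
open import Algebra.Bundles.Raw using (RawRing)
import Algebra.Definitions.RawMonoid as RawMonoidDefs
import Algebra.Definitions.RawSemiring as RawSemiringDefs
open import Algebra.Properties.CommutativeMonoid.Sum using (sum-cong-≗)
open import Data.Fin.Base using (Fin; zero; suc; toℕ)
open import Data.Integer.Base as ℤ using (ℤ; 0ℤ; 1ℤ)
import Data.Integer.Properties as ℤ
open import Data.List.Base using (List; []; _∷_; foldr; map)
open import Data.List.Relation.Unary.All using (All; []; _∷_)
open import Data.Nat.Base using (ℕ; zero; suc; _∸_; _<_)
open import Data.Vec.Functional as Vector using (Vector)
open import Relation.Binary.PropositionalEquality

∑ : ∀ {n} → Vector ℤ n → ℤ
∑ = RawMonoidDefs.sum ℤ.+-0-rawMonoid

-- A series is its sequence of coefficients: f n is the coefficient of qⁿ.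
Series : Set
Series = ℕ → ℤ

constant : ℤ → Series
constant k zero    = k
constant k (suc n) = 0ℤ

infixl 7 _⊛_
_⊛_ : Series → Series → Series
(f ⊛ g) n = ∑ {suc n} λ k → f (toℕ k) ℤ.* g (n ∸ toℕ k)

ℤ⟦q⟧ : RawRing 0ℓ 0ℓ
ℤ⟦q⟧ = record
  { Carrier = Series
  ; _≈_     = _≗_
  ; _+_     = λ f g n → f n ℤ.+ g n
  ; _*_     = _⊛_
  ; -_      = λ f n → ℤ.- f n
  ; 0#      = constant 0ℤ
  ; 1#      = constant 1ℤ
  }

open RawRing ℤ⟦q⟧ public using (_≈_; _+_; _*_; -_; 0#; 1#; rawSemiring)
open RawSemiringDefs rawSemiring public using (_^_; product)

infixl 6 _-_
_-_ : Series → Series → Series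
f - g = f + (- g)

q : Series
q 1 = 1ℤ
q _ = 0ℤ

-- ⦅ x ⨾ p ⦆ n is (x;p)ₙ, for arbitrary series x and p.
⦅_⨾_⦆ : Series → Series → ℕ → Series
⦅ x ⨾ p ⦆ n = product {n} λ j → 1# - x * p ^ toℕ j

-- ⦅ x₁ ∷ … ∷ xᵣ ∷ [] ⨾⨾ p ⦆ n is (x₁,…,xᵣ;p)ₙ.
⦅_⨾⨾_⦆ : List Series → Series → ℕ → Series
⦅ xs ⨾⨾ p ⦆ n = foldr _*_ 1# (map (λ x → ⦅ x ⨾ p ⦆ n) xs)

-- The reciprocal g of a series f with constant term 1 is determined by
-- g₀ = 1 and gₙ = - ∑_{k=1}^{n} fₖ gₙ₋ₖ.  On any other f the value is
-- meaningless; ⁻¹-inverseʳ and ⦅⨾⨾⦆-constantTerm show that products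
-- (x₁,…,xᵣ;p)ₙ in which every xᵢ has constant term 0 have a true reciprocal.
--
-- recip-step computes gₙ from the vector gₙ₋₁ , … , g₀, which is recip-prefix.
recip-step : Series → (n : ℕ) → Vector ℤ n → ℤ
recip-step f zero    gs = 1ℤ
recip-step f (suc n) gs = ℤ.- ∑ λ k → f (suc (toℕ k)) ℤ.* gs k

recip-prefix : Series → (n : ℕ) → Vector ℤ n
recip-prefix f zero    = Vector.[]
recip-prefix f (suc n) = recip-step f n (recip-prefix f n) Vector.∷ recip-prefix f n

infix 9 _⁻¹
_⁻¹ : Series → Series
(f ⁻¹) n = recip-step f n (recip-prefix f n)

infix 4 _⪰0
_⪰0 : Series → Set
f ⪰0 = ∀ n → 0ℤ ℤ.≤ f n

recip-prefix-lookup : ∀ f n (k : Fin (suc n)) →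
                      recip-prefix f (suc n) k ≡ (f ⁻¹) (n ∸ toℕ k)
recip-prefix-lookup f n       zero    = refl
recip-prefix-lookup f (suc n) (suc k) = recip-prefix-lookup f n k

⁻¹-inverseʳ : ∀ f → f 0 ≡ 1ℤ → f * f ⁻¹ ≈ 1#
⁻¹-inverseʳ f f₀≡1 zero    rewrite f₀≡1 = refl
⁻¹-inverseʳ f f₀≡1 (suc n) = begin
  f 0 ℤ.* (ℤ.- S) ℤ.+ T  ≡⟨ cong (λ z → z ℤ.* (ℤ.- S) ℤ.+ T) f₀≡1 ⟩
  1ℤ ℤ.* (ℤ.- S) ℤ.+ T   ≡⟨ cong (ℤ._+ T) (ℤ.*-identityˡ (ℤ.- S)) ⟩
  ℤ.- S ℤ.+ T            ≡⟨ cong (λ z → ℤ.- S ℤ.+ z) S≡T ⟨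
  ℤ.- S ℤ.+ S            ≡⟨ ℤ.+-inverseˡ S ⟩
  0ℤ                     ∎
  where
  open ≡-Reasoning
  S T : ℤ
  S = ∑ {suc n} λ k → f (suc (toℕ k)) ℤ.* recip-prefix f (suc n) k
  T = ∑ {suc n} λ k → f (suc (toℕ k)) ℤ.* (f ⁻¹) (n ∸ toℕ k)
  S≡T : S ≡ T
  S≡T = sum-cong-≗ ℤ.+-0-commutativeMonoid
          λ k → cong (f (suc (toℕ k)) ℤ.*_) (recip-prefix-lookup f n k)

*-constantTerm : ∀ f g → (f * g) 0 ≡ f 0 ℤ.* g 0
*-constantTerm f g = ℤ.+-identityʳ (f 0 ℤ.* g 0)

q^-constantTerm : ∀ s → 0 < s → (q ^ s) 0 ≡ 0ℤ
q^-constantTerm (suc s) _ = *-constantTerm q (q ^ s)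

product-constantTerm : ∀ n (F : Vector Series n) → (∀ j → F j 0 ≡ 1ℤ) →
                       product F 0 ≡ 1ℤ
product-constantTerm zero    F F₀≡1 = refl
product-constantTerm (suc n) F F₀≡1 =
  trans (*-constantTerm (F zero) (product (λ j → F (suc j))))
        (cong₂ ℤ._*_ (F₀≡1 zero)
          (product-constantTerm n (λ j → F (suc j)) (λ j → F₀≡1 (suc j))))

⦅⨾⦆-constantTerm : ∀ x p n → x 0 ≡ 0ℤ → ⦅ x ⨾ p ⦆ n 0 ≡ 1ℤ
⦅⨾⦆-constantTerm x p n x₀≡0 = product-constantTerm n _ λ j →
  cong (λ z → 1ℤ ℤ.+ ℤ.- z)
    (trans (*-constantTerm x (p ^ toℕ j))
           (cong (ℤ._* (p ^ toℕ j) 0) x₀≡0))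

⦅⨾⨾⦆-constantTerm : ∀ {xs} p n → All (λ x → x 0 ≡ 0ℤ) xs → ⦅ xs ⨾⨾ p ⦆ n 0 ≡ 1ℤ
⦅⨾⨾⦆-constantTerm          p n []             = refl
⦅⨾⨾⦆-constantTerm {x ∷ xs} p n (x₀≡0 ∷ xs₀≡0) =
  trans (*-constantTerm (⦅ x ⨾ p ⦆ n) (⦅ xs ⨾⨾ p ⦆ n))
        (cong₂ ℤ._*_ (⦅⨾⦆-constantTerm x p n x₀≡0) (⦅⨾⨾⦆-constantTerm p n xs₀≡0))

{-# OPTIONS --safe #-}
module Submission where

-- The coefficient of qᴺ in 1 / (qᵃ,qᵇ;qᴹ)_L counts the pairs (u , v) of multiplicity
-- vectors of the parts a + Mj and b + Mj (j < L) with total N.  Put m = ∑ u and n = ∑ v.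
-- Since a + b = 1 + c, retyping min(m,n) pairs {a, b} as pairs {1, c} and the remaining
-- |m - n| letters a (or b) as a (or b) times as many letters 1 preserves N, provided
-- that the longer of u and v becomes the vector of letters 1 and that the new letters 1
-- are placed at j = 0.  Images from m > n and from m < n can only coincide
-- when the surplus of letters 1 over letters c is divisible by both a and b.  In that
-- case, for m < n, a further a + b of that surplus are traded for one pair {1, c}: this
-- is possible because a ∤ b, and the new surplus is a multiple of neither a nor b.

open import Defs
open import Data.Fin.Base using (Fin; zero; suc; toℕ)
open import Data.Fin.Properties using (+↔⊎; injective⇒≤)
open import Data.Integer.Base as ℤ using (0ℤ; 1ℤ; -1ℤ)
import Data.Integer.Properties as ℤ
open import Data.Integer.Tactic.RingSolver using (solve-∀)
open import Data.List.Base using ([]; _∷_)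
open import Data.List.Relation.Unary.All using ([]; _∷_)
open import Data.Nat.Base as ℕ using (ℕ; zero; suc; _≤_; _<_; s≤s; NonZero; >-nonZero)
open import Data.Nat.Divisibility using (_∣_; _∤_; _∣?_; m∣m*n; ∣m+n∣m⇒∣n; ∣-refl; ∣⇒≤)
open import Data.Nat.Induction using (<-rec)
import Data.Nat.Properties as ℕ
import Data.Nat.Tactic.RingSolver as ℕ-solver
open import Data.Product.Base using (∃; _×_; _,_; proj₁; proj₂)
open import Data.Product.Properties using (,-injective)
open import Data.Sum.Base using (_⊎_; inj₁; inj₂)
open import Data.Sum.Function.Propositional using (_⊎-↔_)
open import Data.Unit.Base using (⊤; tt)
open import Data.Vec.Base as Vec using (Vec; []; _∷_)
open import Function.Base using (_∘_)
open import Function.Bundles using (_↔_; Inverse; Injection; mk↔ₛ′)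
open import Function.Properties.Inverse using (↔-sym; ↔-trans; ↔⇒↣)
open import Relation.Binary.PropositionalEquality
open import Relation.Nullary.Decidable.Core using (yes; no)
open import Relation.Nullary.Negation using (contradiction)

open ≡-Reasoning

-- Convolution algebra of power series.

-- `(f * g) (suc n)` unfolds to `f 0 ℤ.* g (suc n) ℤ.+ ((f ∘ suc) * g) n`. This drives the induction
-- here and in the laws below, with `f` replaced by its tail.
⊛-cong : ∀ {f f′ g g′} → f ≈ f′ → g ≈ g′ → f * g ≈ f′ * g′
⊛-cong f≈ g≈ zero    = cong (ℤ._+ 0ℤ) (cong₂ ℤ._*_ (f≈ 0) (g≈ 0))
⊛-cong f≈ g≈ (suc n) = cong₂ ℤ._+_ (cong₂ ℤ._*_ (f≈ 0) (g≈ (suc n))) (⊛-cong (f≈ ∘ suc) g≈ n)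

⊛-zeroˡ : ∀ {f} → (∀ n → f n ≡ 0ℤ) → ∀ g n → (f * g) n ≡ 0ℤ
⊛-zeroˡ f≈0 g zero    = cong (λ z → z ℤ.* g 0 ℤ.+ 0ℤ) (f≈0 0)
⊛-zeroˡ f≈0 g (suc n) = cong₂ (λ y z → y ℤ.* g (suc n) ℤ.+ z) (f≈0 0) (⊛-zeroˡ (f≈0 ∘ suc) g n)

⊛-identityˡ : ∀ g → 1# * g ≈ g
⊛-identityˡ g zero    = trans (ℤ.+-identityʳ _) (ℤ.*-identityˡ (g 0))
⊛-identityˡ g (suc n) = trans
  (cong₂ ℤ._+_ (ℤ.*-identityˡ (g (suc n))) (⊛-zeroˡ (λ _ → refl) g n)) (ℤ.+-identityʳ _)

⊛-distribʳ : ∀ h f g → (f + g) * h ≈ f * h + g * h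
⊛-distribʳ h f g zero    = distrib (f 0) (g 0) (h 0)
  where
  distrib : ∀ x y z → (x ℤ.+ y) ℤ.* z ℤ.+ 0ℤ ≡ (x ℤ.* z ℤ.+ 0ℤ) ℤ.+ (y ℤ.* z ℤ.+ 0ℤ)
  distrib = solve-∀
⊛-distribʳ h f g (suc n) = trans
  (cong (λ z → (f 0 ℤ.+ g 0) ℤ.* h (suc n) ℤ.+ z) (⊛-distribʳ h (f ∘ suc) (g ∘ suc) n))
  (distrib (f 0) (g 0) (h (suc n)) _ _)
  where
  distrib : ∀ x y z u v →
            (x ℤ.+ y) ℤ.* z ℤ.+ (u ℤ.+ v) ≡ (x ℤ.* z ℤ.+ u) ℤ.+ (y ℤ.* z ℤ.+ v)
  distrib = solve-∀

⊛-scaleˡ : ∀ k f g n → ((λ m → k ℤ.* f m) * g) n ≡ k ℤ.* (f * g) n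
⊛-scaleˡ k f g zero    = scale k (f 0) (g 0)
  where
  scale : ∀ x y z → x ℤ.* y ℤ.* z ℤ.+ 0ℤ ≡ x ℤ.* (y ℤ.* z ℤ.+ 0ℤ)
  scale = solve-∀
⊛-scaleˡ k f g (suc n) = trans
  (cong (λ z → k ℤ.* f 0 ℤ.* g (suc n) ℤ.+ z) (⊛-scaleˡ k (f ∘ suc) g n))
  (scale k (f 0) (g (suc n)) _)
  where
  scale : ∀ x y z u → x ℤ.* y ℤ.* z ℤ.+ x ℤ.* u ≡ x ℤ.* (y ℤ.* z ℤ.+ u)
  scale = solve-∀

⊛-assoc : ∀ f g h → (f * g) * h ≈ f * (g * h)
⊛-assoc f g h zero    = assoc (f 0) (g 0) (h 0)
  where
  assoc : ∀ x y z → (x ℤ.* y ℤ.+ 0ℤ) ℤ.* z ℤ.+ 0ℤ ≡ x ℤ.* (y ℤ.* z ℤ.+ 0ℤ) ℤ.+ 0ℤ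
  assoc = solve-∀
⊛-assoc f g h (suc n) = begin
  -- The tail of `f * g` is `f 0` times the tail of `g`, plus `(f ∘ suc) * g`.
  (f 0 ℤ.* g 0 ℤ.+ 0ℤ) ℤ.* h (suc n) ℤ.+ (((λ m → f 0 ℤ.* g (suc m)) + (f ∘ suc) * g) * h) n
    ≡⟨ cong (λ z → (f 0 ℤ.* g 0 ℤ.+ 0ℤ) ℤ.* h (suc n) ℤ.+ z)
         (⊛-distribʳ h (λ m → f 0 ℤ.* g (suc m)) ((f ∘ suc) * g) n) ⟩
  (f 0 ℤ.* g 0 ℤ.+ 0ℤ) ℤ.* h (suc n) ℤ.+
    (((λ m → f 0 ℤ.* g (suc m)) * h) n ℤ.+ (((f ∘ suc) * g) * h) n)
    ≡⟨ cong₂ (λ y z → (f 0 ℤ.* g 0 ℤ.+ 0ℤ) ℤ.* h (suc n) ℤ.+ (y ℤ.+ z))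
         (⊛-scaleˡ (f 0) (g ∘ suc) h n) (⊛-assoc (f ∘ suc) g h n) ⟩
  (f 0 ℤ.* g 0 ℤ.+ 0ℤ) ℤ.* h (suc n) ℤ.+
    (f 0 ℤ.* ((g ∘ suc) * h) n ℤ.+ ((f ∘ suc) * (g * h)) n)
    ≡⟨ regroup (f 0) (g 0) (h (suc n)) _ _ ⟩
  f 0 ℤ.* (g 0 ℤ.* h (suc n) ℤ.+ ((g ∘ suc) * h) n) ℤ.+ ((f ∘ suc) * (g * h)) n ∎
  where
  regroup : ∀ x y z u v →
            (x ℤ.* y ℤ.+ 0ℤ) ℤ.* z ℤ.+ (x ℤ.* u ℤ.+ v) ≡ x ℤ.* (y ℤ.* z ℤ.+ u) ℤ.+ v
  regroup = solve-∀

⊛-negˡ : ∀ f g → (- f) * g ≈ - (f * g)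
⊛-negˡ f g n = begin
  ((- f) * g) n                   ≡⟨ ⊛-cong {g = g} (λ m → sym (ℤ.-1*i≡-i (f m))) (λ _ → refl) n ⟩
  ((λ m → -1ℤ ℤ.* f m) * g) n     ≡⟨ ⊛-scaleˡ -1ℤ f g n ⟩
  -1ℤ ℤ.* (f * g) n               ≡⟨ ℤ.-1*i≡-i _ ⟩
  ℤ.- (f * g) n                   ∎

[1-x]⊛g : ∀ x g → (1# - x) * g ≈ g - x * g
[1-x]⊛g x g n = trans (⊛-distribʳ g 1# (- x) n) (cong₂ ℤ._+_ (⊛-identityˡ g n) (⊛-negˡ x g n))

-- Monomials as shifts.

shift : ℕ → Series → Series
shift zero    g n       = g n
shift (suc d) g zero    = 0ℤ
shift (suc d) g (suc n) = shift d g n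

shift-cong : ∀ d {f g} → f ≈ g → shift d f ≈ shift d g
shift-cong zero    f≈g n       = f≈g n
shift-cong (suc d) f≈g zero    = refl
shift-cong (suc d) f≈g (suc n) = shift-cong d f≈g n

shift-+ : ∀ d e g → shift d (shift e g) ≈ shift (d ℕ.+ e) g
shift-+ zero    e g n       = refl
shift-+ (suc d) e g zero    = refl
shift-+ (suc d) e g (suc n) = shift-+ d e g n

shift-< : ∀ {n d} g → n < d → shift d g n ≡ 0ℤ
shift-< {zero}  g (s≤s n<d) = refl
shift-< {suc n} g (s≤s n<d) = shift-< g n<d

shift-≥ : ∀ d g n → shift d g (d ℕ.+ n) ≡ g n
shift-≥ zero    g n = refl
shift-≥ (suc d) g n = shift-≥ d g n

-- A power of `q` is described by its action on series, so that products of monomials become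
-- composites of shifts.
record Monomial (d : ℕ) (x : Series) : Set where
  constructor monomial
  field *≈shift : ∀ g → x * g ≈ shift d g

open Monomial

1-monomial : Monomial 0 1#
1-monomial = monomial ⊛-identityˡ

q-monomial : Monomial 1 q
q-monomial = monomial λ where
  g zero    → refl
  g (suc n) → trans (ℤ.+-identityˡ _) (trans
    (⊛-cong {q ∘ suc} {1#} {g} (λ { zero → refl ; (suc _) → refl }) (λ _ → refl) n)
    (⊛-identityˡ g n))

*-monomial : ∀ {d e x y} → Monomial d x → Monomial e y → Monomial (d ℕ.+ e) (x * y)
*-monomial {d} {e} {x} {y} (monomial x*) (monomial y*) = monomial λ g n → begin
  ((x * y) * g) n          ≡⟨ ⊛-assoc x y g n ⟩
  (x * (y * g)) n          ≡⟨ x* (y * g) n ⟩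
  shift d (y * g) n        ≡⟨ shift-cong d (y* g) n ⟩
  shift d (shift e g) n    ≡⟨ shift-+ d e g n ⟩
  shift (d ℕ.+ e) g n      ∎

^-monomial : ∀ {d x} n → Monomial d x → Monomial (n ℕ.* d) (x ^ n)
^-monomial zero    mx = 1-monomial
^-monomial (suc n) mx = *-monomial mx (^-monomial n mx)

q^-monomial : ∀ d → Monomial d (q ^ d)
q^-monomial d = subst (λ e → Monomial e (q ^ d)) (ℕ.*-identityʳ d) (^-monomial d q-monomial)

-- Generating functions of weighted sets.

Fiber : {X : Set} → (X → ℕ) → ℕ → Set
Fiber w n = ∃ λ x → w x ≡ n

Fiber-≡ : ∀ {X : Set} {w : X → ℕ} {n} {x y : X} {p : w x ≡ n} {r : w y ≡ n} →
          x ≡ y → _≡_ {A = Fiber w n} (x , p) (y , r)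
Fiber-≡ refl = cong (_ ,_) (ℕ.≡-irrelevant _ _)

infix 4 _counts_
-- `f` is the generating function of `w`; the bijection with `Fin k` records that each fibre is
-- finite, of size the coefficient.
_counts_ : {X : Set} → Series → (X → ℕ) → Set
f counts w = ∀ n → ∃ λ k → (f n ≡ ℤ.+ k) × (Fin k ↔ Fiber w n)

counts-≈ : ∀ {X : Set} {w : X → ℕ} {f g} → g ≈ f → f counts w → g counts w
counts-≈ g≈f f# n = let k , fn≡k , i = f# n in k , trans (g≈f n) fn≡k , i

counts-reindex : ∀ {X Y : Set} {w : X → ℕ} {w′ : Y → ℕ} {f} (i : X ↔ Y) →
                 (∀ x → w′ (Inverse.to i x) ≡ w x) → f counts w → f counts w′
counts-reindex {w = w} {w′} i w′∘to≗w f# n = let k , fn≡k , j = f# n in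
  k , fn≡k , ↔-trans j (mk↔ₛ′
    (λ (x , p) → to x , trans (w′∘to≗w x) p)
    (λ (y , p) → from y , trans (sym (w′∘to≗w (from y))) (trans (cong w′ (strictlyInverseˡ y)) p))
    (λ (y , p) → Fiber-≡ (strictlyInverseˡ y))
    (λ (x , p) → Fiber-≡ (strictlyInverseʳ x)))
  where open Inverse i

counts-1# : 1# counts (λ (_ : ⊤) → 0)
counts-1# zero    = 1 , refl , mk↔ₛ′ (λ _ → tt , refl) (λ _ → zero) (λ _ → Fiber-≡ refl) (λ { zero → refl })
counts-1# (suc n) = 0 , refl , mk↔ₛ′ (λ ()) (λ ()) (λ ()) (λ ())

module _ {X : Set} (w : X → ℕ) (d : ℕ) where

  withMultiple : ℕ × X → ℕ
  withMultiple (k , x) = k ℕ.* d ℕ.+ w x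

  Fiber-< : ∀ {n} → n < d → Fiber w n ↔ Fiber withMultiple n
  Fiber-< {n} n<d = mk↔ₛ′ to from invˡ (λ _ → refl)
    where
    d≰ : ∀ k x → withMultiple (suc k , x) ≢ n
    d≰ k x p = ℕ.<⇒≱ n<d (subst (d ℕ.≤_) p
      (ℕ.≤-trans (ℕ.m≤m+n d (k ℕ.* d)) (ℕ.m≤m+n (suc k ℕ.* d) (w x))))
    to : Fiber w n → Fiber withMultiple n
    to (x , p) = (0 , x) , p
    from : Fiber withMultiple n → Fiber w n
    from ((zero  , x) , p) = x , p
    from ((suc k , x) , p) = contradiction p (d≰ k x)
    invˡ : ∀ y → to (from y) ≡ y
    invˡ ((zero  , x) , p) = refl
    invˡ ((suc k , x) , p) = contradiction p (d≰ k x)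

  -- Either the multiplicity of `d` is 0, or one copy of `d` can be removed.
  Fiber-≥ : ∀ n → (Fiber w (d ℕ.+ n) ⊎ Fiber withMultiple n) ↔ Fiber withMultiple (d ℕ.+ n)
  Fiber-≥ n = mk↔ₛ′ to from invˡ invʳ
    where
    assoc : ∀ k x → withMultiple (suc k , x) ≡ d ℕ.+ withMultiple (k , x)
    assoc k x = ℕ.+-assoc d (k ℕ.* d) (w x)
    to : Fiber w (d ℕ.+ n) ⊎ Fiber withMultiple n → Fiber withMultiple (d ℕ.+ n)
    to (inj₁ (x , p))       = (0 , x) , p
    to (inj₂ ((k , x) , p)) = (suc k , x) , trans (assoc k x) (cong (d ℕ.+_) p)
    from : Fiber withMultiple (d ℕ.+ n) → Fiber w (d ℕ.+ n) ⊎ Fiber withMultiple n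
    from ((zero  , x) , p) = inj₁ (x , p)
    from ((suc k , x) , p) = inj₂ ((k , x) , ℕ.+-cancelˡ-≡ d _ _ (trans (sym (assoc k x)) p))
    invˡ : ∀ y → to (from y) ≡ y
    invˡ ((zero  , x) , p) = refl
    invˡ ((suc k , x) , p) = Fiber-≡ refl
    invʳ : ∀ y → from (to y) ≡ y
    invʳ (inj₁ _) = refl
    invʳ (inj₂ _) = cong inj₂ (Fiber-≡ refl)

  -- The recurrence says that `g` is `f / (1 - q^d)`; the new component of `withMultiple` is the
  -- number of copies of the part `d`. As `0 < d`, the recurrence refers to an earlier coefficient,
  -- so strong induction applies.
  counts-geometric : ∀ {f g} → 0 < d → g ≈ f + shift d g → f counts w → g counts withMultiple
  counts-geometric {f} {g} 0<d g≈ f# = <-rec _ step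
    where
    step : ∀ n → (∀ {m} → m < n → ∃ λ k → (g m ≡ ℤ.+ k) × (Fin k ↔ Fiber withMultiple m)) →
           ∃ λ k → (g n ≡ ℤ.+ k) × (Fin k ↔ Fiber withMultiple n)
    step n rec with f# n | n ℕ.<? d
    ... | k , fn≡k , i | yes n<d = k ,
      trans (g≈ n) (trans (cong₂ ℤ._+_ fn≡k (shift-< g n<d)) (ℤ.+-identityʳ _)) ,
      ↔-trans i (Fiber-< n<d)
    ... | k , fn≡k , i | no n≮d with ℕ.m≤n⇒∃[o]m+o≡n (ℕ.≮⇒≥ n≮d)
    ... | m , refl with rec (ℕ.m<n+m m 0<d)
    ... | l , gm≡l , j = k ℕ.+ l ,
      trans (g≈ n) (cong₂ ℤ._+_ fn≡k (trans (shift-≥ d g m) gm≡l)) ,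
      ↔-trans +↔⊎ (↔-trans (i ⊎-↔ j) (Fiber-≥ m))

-- Multiplicity vectors and products of geometric series.

weight : ∀ {n} → (Fin n → ℕ) → Vec ℕ n → ℕ
weight d []      = 0
weight d (k ∷ v) = k ℕ.* d zero ℕ.+ weight (d ∘ suc) v

infixr 5 _⊕_
_⊕_ : {X Y : Set} → (X → ℕ) → (Y → ℕ) → X × Y → ℕ
(w ⊕ w′) (x , y) = w x ℕ.+ w′ y

[]×-↔ : ∀ {X : Set} → X ↔ (Vec ℕ 0 × X)
[]×-↔ = mk↔ₛ′ ([] ,_) proj₂ (λ { ([] , x) → refl }) (λ _ → refl)

∷×-↔ : ∀ {n} {X : Set} → (Vec ℕ n × ℕ × X) ↔ (Vec ℕ (suc n) × X)
∷×-↔ {n} {X} = mk↔ₛ′ (λ (v , k , x) → k ∷ v , x) from (λ { (k ∷ v , x) → refl }) (λ _ → refl)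
  where
  from : Vec ℕ (suc n) × X → Vec ℕ n × ℕ × X
  from (k ∷ v , x) = v , k , x

-- Division is avoided by stating the quotient as an equation. Read as
-- `(1# - x zero) * (P * g) ≈ f`, it lets `counts-geometric` count `P * g`, which takes the place of
-- `f` for the remaining factors.
counts-product : ∀ {L} {X : Set} {w : X → ℕ} {f} (x : Fin L → Series) (d : Fin L → ℕ) →
                 (∀ j → 0 < d j) → (∀ j → Monomial (d j) (x j)) → f counts w →
                 ∀ g → product (λ j → 1# - x j) * g ≈ f → g counts (weight d ⊕ w)
counts-product {zero} x d 0<d mx f# g ≈f =
  counts-reindex []×-↔ (λ _ → refl)
    (counts-≈ (λ n → trans (sym (⊛-identityˡ g n)) (≈f n)) f#)
counts-product {suc L} {w = w} {f} x d 0<d mx f# g ≈f =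
  counts-reindex ∷×-↔
    (λ (v , k , y) → swap (k ℕ.* d zero) (weight (d ∘ suc) v) (w y))
    (counts-product (x ∘ suc) (d ∘ suc) (0<d ∘ suc) (mx ∘ suc) counts-P*g g (λ _ → refl))
  where
  P = product (λ j → 1# - x (suc j))
  swap : ∀ i j k → i ℕ.+ j ℕ.+ k ≡ j ℕ.+ (i ℕ.+ k)
  swap = ℕ-solver.solve-∀
  move : ∀ {i j k} → i ℤ.- j ≡ k → i ≡ k ℤ.+ j
  move {i} {j} refl = cancel i j
    where
    cancel : ∀ i j → i ≡ i ℤ.- j ℤ.+ j
    cancel = solve-∀
  P*g≈ : P * g ≈ f + shift (d zero) (P * g)
  P*g≈ n = trans
    (move (trans (sym ([1-x]⊛g (x zero) (P * g) n)) (trans (sym (⊛-assoc (1# - x zero) P g n)) (≈f n))))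
    (cong (λ z → f n ℤ.+ z) (*≈shift (mx zero) (P * g) n))
  counts-P*g : P * g counts withMultiple w (d zero)
  counts-P*g = counts-geometric w (d zero) (0<d zero) P*g≈ f#

-- A weight-preserving injection restricts to fibres, and an injection from `Fin l` to `Fin k`
-- forces `l ≤ k`.
⪰0-from-injection : ∀ {X Y : Set} {w : X → ℕ} {w′ : Y → ℕ} {f g} → f counts w → g counts w′ →
  (φ : Y → X) → (∀ y → w (φ y) ≡ w′ y) → (∀ {y z} → φ y ≡ φ z → y ≡ z) → f - g ⪰0
⪰0-from-injection {w = w} {w′} {f} {g} f# g# φ w∘φ≗w′ φ-injective n with f# n | g# n
... | k , fn≡k , i | l , gn≡l , j =
  subst (0ℤ ℤ.≤_) (cong₂ ℤ._-_ (sym fn≡k) (sym gn≡l))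
    (ℤ.i≤j⇒0≤j-i (ℤ.+≤+ (injective⇒≤ {f = h} h-injective)))
  where
  module I = Inverse i
  module J = Inverse j
  Φ : Fiber w′ n → Fiber w n
  Φ (y , p) = φ y , trans (w∘φ≗w′ y) p
  Φ-injective : ∀ {y z} → Φ y ≡ Φ z → y ≡ z
  Φ-injective eq = Fiber-≡ (φ-injective (cong proj₁ eq))
  h : Fin l → Fin k
  h = I.from ∘ Φ ∘ J.to
  h-injective : ∀ {x y} → h x ≡ h y → x ≡ y
  h-injective {x} {y} eq = Injection.injective (↔⇒↣ j)
    (Φ-injective (Injection.injective (↔⇒↣ (↔-sym i)) eq))

-- Reciprocals as counts of pairs of multiplicity vectors.

pairWeight : ∀ {L} → (Fin L → ℕ) → ℕ → ℕ → Vec ℕ L × Vec ℕ L → ℕ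
pairWeight e a b = weight (λ j → a ℕ.+ e j) ⊕ weight (λ j → b ℕ.+ e j)

-- The reciprocal enters through `A * (B*1 * g) ≈ 1#`: peeling off `A` counts `B*1 * g`, and peeling
-- off `B` from that counts `g`.
counts-⦅⨾⨾⦆⁻¹ : ∀ {a b x y} M L → 0 < a → 0 < b → x 0 ≡ 0ℤ → y 0 ≡ 0ℤ →
                Monomial a x → Monomial b y →
                (⦅ x ∷ y ∷ [] ⨾⨾ q ^ M ⦆ L) ⁻¹ counts pairWeight {L} (λ j → toℕ j ℕ.* M) a b
counts-⦅⨾⨾⦆⁻¹ {a} {b} {x} {y} M L 0<a 0<b x₀≡0 y₀≡0 mx my =
  counts-reindex
    (mk↔ₛ′ (λ (v , u , tt) → u , v) (λ (u , v) → v , u , tt) (λ _ → refl) (λ _ → refl))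
    (λ (v , u , tt) → comm (weight _ v) (weight _ u))
    (peel y my 0<b (peel x mx 0<a counts-1# (B*1 * g)
        (λ n → trans (sym (⊛-assoc A B*1 g n)) (⁻¹-inverseʳ (A * B*1) F₀≡1 n)))
      g (λ n → sym (trans (⊛-assoc B 1# g n) (⊛-cong {B} {B} (λ _ → refl) (⊛-identityˡ g) n))))
  where
  A B B*1 g : Series
  A = ⦅ x ⨾ q ^ M ⦆ L
  B = ⦅ y ⨾ q ^ M ⦆ L
  B*1 = B * 1#
  g = (⦅ x ∷ y ∷ [] ⨾⨾ q ^ M ⦆ L) ⁻¹
  F₀≡1 : (A * B*1) 0 ≡ 1ℤ
  F₀≡1 = ⦅⨾⨾⦆-constantTerm {x ∷ y ∷ []} (q ^ M) L (x₀≡0 ∷ y₀≡0 ∷ [])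
  comm : ∀ i j → j ℕ.+ i ≡ i ℕ.+ (j ℕ.+ 0)
  comm = ℕ-solver.solve-∀
  peel : ∀ {d} x → Monomial d x → 0 < d → ∀ {X : Set} {w : X → ℕ} {f} → f counts w →
         ∀ g → ⦅ x ⨾ q ^ M ⦆ L * g ≈ f → g counts (weight {L} (λ j → d ℕ.+ toℕ j ℕ.* M) ⊕ w)
  peel {d} x mx 0<d = counts-product (λ j → x * (q ^ M) ^ toℕ j) (λ j → d ℕ.+ toℕ j ℕ.* M)
    (λ j → ℕ.<-≤-trans 0<d (ℕ.m≤m+n d _)) (λ j → *-monomial mx (^-monomial (toℕ j) (q^-monomial M)))

-- Letters, positions and surpluses.

-- Separates the letters from their positions: retyping all letters of a vector leaves `weight e v`
-- alone, so only the sums need balancing.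
weight-+ : ∀ {n} a (e : Fin n → ℕ) v → weight (λ j → a ℕ.+ e j) v ≡ a ℕ.* Vec.sum v ℕ.+ weight e v
weight-+ a e []      = sym (trans (ℕ.+-identityʳ _) (ℕ.*-zeroʳ a))
weight-+ a e (k ∷ v) = trans (cong (k ℕ.* (a ℕ.+ e zero) ℕ.+_) (weight-+ a (e ∘ suc) v))
  (regroup k a (e zero) (Vec.sum v) _)
  where
  regroup : ∀ k a e s w →
    k ℕ.* (a ℕ.+ e) ℕ.+ (a ℕ.* s ℕ.+ w) ≡ a ℕ.* (k ℕ.+ s) ℕ.+ (k ℕ.* e ℕ.+ w)
  regroup = ℕ-solver.solve-∀

addToHead : ∀ {n} → ℕ → Vec ℕ (suc n) → Vec ℕ (suc n)
addToHead k (m ∷ v) = k ℕ.+ m ∷ v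

sum-addToHead : ∀ {n} k (v : Vec ℕ (suc n)) → Vec.sum (addToHead k v) ≡ k ℕ.+ Vec.sum v
sum-addToHead k (m ∷ v) = ℕ.+-assoc k m (Vec.sum v)

weight-addToHead : ∀ {n} {e : Fin (suc n) → ℕ} → e zero ≡ 0 →
                   ∀ k v → weight e (addToHead k v) ≡ weight e v
weight-addToHead {e = e} e₀≡0 k (m ∷ v) = cong (ℕ._+ weight (e ∘ suc) v) (begin
  (k ℕ.+ m) ℕ.* e zero  ≡⟨ cong ((k ℕ.+ m) ℕ.*_) e₀≡0 ⟩
  (k ℕ.+ m) ℕ.* 0       ≡⟨ ℕ.*-zeroʳ (k ℕ.+ m) ⟩
  0                     ≡⟨ ℕ.*-zeroʳ m ⟨
  m ℕ.* 0               ≡⟨ cong (m ℕ.*_) e₀≡0 ⟨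
  m ℕ.* e zero          ∎)

addToHead-injective : ∀ {n} k {u v : Vec ℕ (suc n)} → addToHead k u ≡ addToHead k v → u ≡ v
addToHead-injective k {l ∷ u} {m ∷ v} eq =
  cong₂ _∷_ (ℕ.+-cancelˡ-≡ k l m (cong Vec.head eq)) (cong Vec.tail eq)

weight-+-addToHead : ∀ {n} {e : Fin (suc n) → ℕ} → e zero ≡ 0 → ∀ d k v →
                     weight (λ j → d ℕ.+ e j) (addToHead k v) ≡
                     d ℕ.* (k ℕ.+ Vec.sum v) ℕ.+ weight e v
weight-+-addToHead {e = e} e₀≡0 d k v = trans (weight-+ d e (addToHead k v))
  (cong₂ (λ y z → d ℕ.* y ℕ.+ z) (sum-addToHead k v) (weight-addToHead e₀≡0 k v))

-- The `t` pairs are exchanged by `1 + c ≡ a + b`. The `r` surplus letters `a`, retyped as 1, need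
-- `k` further letters 1 to restore `a * r`.
balance : ∀ a b {c s t} r k E F → 1 ℕ.+ c ≡ a ℕ.+ b → s ≡ t ℕ.+ r → k ℕ.+ r ≡ a ℕ.* r →
          (1 ℕ.* (k ℕ.+ s) ℕ.+ E) ℕ.+ (c ℕ.* t ℕ.+ F) ≡ (a ℕ.* s ℕ.+ E) ℕ.+ (b ℕ.* t ℕ.+ F)
balance a b {c} {_} {t} r k E F 1+c≡ refl k+r≡ = begin
  (1 ℕ.* (k ℕ.+ (t ℕ.+ r)) ℕ.+ E) ℕ.+ (c ℕ.* t ℕ.+ F)   ≡⟨ collect k r t c E F ⟩
  (k ℕ.+ r) ℕ.+ (1 ℕ.+ c) ℕ.* t ℕ.+ (E ℕ.+ F)           ≡⟨ cong₂ (λ y z → y ℕ.+ z ℕ.* t ℕ.+ (E ℕ.+ F)) k+r≡ 1+c≡ ⟩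
  a ℕ.* r ℕ.+ (a ℕ.+ b) ℕ.* t ℕ.+ (E ℕ.+ F)             ≡⟨ spread a b r t E F ⟩
  (a ℕ.* (t ℕ.+ r) ℕ.+ E) ℕ.+ (b ℕ.* t ℕ.+ F)           ∎
  where
  collect : ∀ k r t c E F → (1 ℕ.* (k ℕ.+ (t ℕ.+ r)) ℕ.+ E) ℕ.+ (c ℕ.* t ℕ.+ F) ≡
                            (k ℕ.+ r) ℕ.+ (1 ℕ.+ c) ℕ.* t ℕ.+ (E ℕ.+ F)
  collect = ℕ-solver.solve-∀
  spread : ∀ a b r t E F → a ℕ.* r ℕ.+ (a ℕ.+ b) ℕ.* t ℕ.+ (E ℕ.+ F) ≡
                           (a ℕ.* (t ℕ.+ r) ℕ.+ E) ℕ.+ (b ℕ.* t ℕ.+ F)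
  spread = ℕ-solver.solve-∀

-- Keeping `c` on the left avoids subtraction: in `collision` the letters 1 fall short of `t ℕ.+ d`
-- by `c`, in the excess cases by nothing.
surplus : ∀ {n d} c k r {t} (u : Vec ℕ (suc n)) → Vec.sum u ≡ t ℕ.+ r → k ℕ.+ (c ℕ.+ r) ≡ d →
          Vec.sum (addToHead k u) ℕ.+ c ≡ t ℕ.+ d
surplus {d = d} c k r {t} u sum≡ k≡ = begin
  Vec.sum (addToHead k u) ℕ.+ c  ≡⟨ cong (ℕ._+ c) (sum-addToHead k u) ⟩
  k ℕ.+ Vec.sum u ℕ.+ c          ≡⟨ cong (λ s → k ℕ.+ s ℕ.+ c) sum≡ ⟩
  k ℕ.+ (t ℕ.+ r) ℕ.+ c          ≡⟨ regroup k t r c ⟩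
  t ℕ.+ (k ℕ.+ (c ℕ.+ r))        ≡⟨ cong (t ℕ.+_) k≡ ⟩
  t ℕ.+ d                        ∎
  where
  regroup : ∀ k s r c → k ℕ.+ (s ℕ.+ r) ℕ.+ c ≡ s ℕ.+ (k ℕ.+ (c ℕ.+ r))
  regroup = ℕ-solver.solve-∀

surplus₀ : ∀ {n d} k r {t} (u : Vec ℕ (suc n)) → Vec.sum u ≡ t ℕ.+ r → k ℕ.+ r ≡ d →
           Vec.sum (addToHead k u) ≡ t ℕ.+ d
surplus₀ k r u sum≡ k≡ = trans (sym (ℕ.+-identityʳ _)) (surplus 0 k r u sum≡ k≡)

-- The image determines its surplus, hence `d * r`, hence `r` since `d` is nonzero, then `k`, and
-- finally `u`.
addToHead-cancel : ∀ {n} d .{{_ : NonZero d}} c {k k′ r r′} {u v u′ v′ : Vec ℕ (suc n)} →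
  Vec.sum u ≡ Vec.sum v ℕ.+ r → Vec.sum u′ ≡ Vec.sum v′ ℕ.+ r′ →
  k ℕ.+ (c ℕ.+ r) ≡ d ℕ.* r → k′ ℕ.+ (c ℕ.+ r′) ≡ d ℕ.* r′ →
  addToHead k u ≡ addToHead k′ u′ → v ≡ v′ → u ≡ u′
addToHead-cancel d c {k} {k′} {r} {r′} {u} {v} {u′} sum≡ sum′≡ k≡ k′≡ eq refl
  with refl ← ℕ.*-cancelˡ-≡ r r′ d (ℕ.+-cancelˡ-≡ (Vec.sum v) _ _ (trans
         (sym (surplus c k r u sum≡ k≡))
         (trans (cong (λ w → Vec.sum w ℕ.+ c) eq) (surplus c k′ r′ u′ sum′≡ k′≡))))
  with refl ← ℕ.+-cancelʳ-≡ (c ℕ.+ r) k k′ (trans k≡ (sym k′≡))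
  = addToHead-injective k eq

surplus-unique : ∀ {n d d′ k k′ r r′} {u v u′ v′ : Vec ℕ (suc n)} →
  Vec.sum u ≡ Vec.sum v ℕ.+ r → Vec.sum u′ ≡ Vec.sum v′ ℕ.+ r′ →
  k ℕ.+ r ≡ d → k′ ℕ.+ r′ ≡ d′ → addToHead k u ≡ addToHead k′ u′ → v ≡ v′ → d ≡ d′
surplus-unique {k = k} {k′} {r} {r′} {u} {v} {u′} sum≡ sum′≡ k≡ k′≡ eq refl =
  ℕ.+-cancelˡ-≡ (Vec.sum v) _ _ (trans (sym (surplus₀ k r u sum≡ k≡))
    (trans (cong Vec.sum eq) (surplus₀ k′ r′ u′ sum′≡ k′≡)))

-- The injection, given by its graph.

module _ {a b c : ℕ} (1<a : 1 < a) (a<b : a < b) (1+c≡a+b : 1 ℕ.+ c ≡ a ℕ.+ b) (a∤b : a ∤ b)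
         {L : ℕ} where

  private
    instance
      a≢0 : NonZero a
      a≢0 = >-nonZero (ℕ.<-trans ℕ.z<s 1<a)
      b≢0 : NonZero b
      b≢0 = >-nonZero (ℕ.<-trans (ℕ.<-trans ℕ.z<s 1<a) a<b)

  Pair : Set
  Pair = Vec ℕ (suc L) × Vec ℕ (suc L)

  infix 4 _↝_
  -- On the right, the sum of the first vector exceeds that of the second by a * r,
  -- b * r and b * r - (a + b) respectively; since neither of a and b divides the
  -- other, divisibility by a and by b tells the constructors apart.
  data _↝_ : Pair → Pair → Set where
    a-excess : ∀ {u v} r k → Vec.sum u ≡ Vec.sum v ℕ.+ r → k ℕ.+ r ≡ a ℕ.* r →
               (u , v) ↝ (addToHead k u , v)
    b-excess : ∀ {u v} r k → Vec.sum v ≡ Vec.sum u ℕ.+ r → k ℕ.+ r ≡ b ℕ.* r → a ∤ b ℕ.* r →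
               (u , v) ↝ (addToHead k v , u)
    collision : ∀ {u v} r k → Vec.sum v ≡ Vec.sum u ℕ.+ r → k ℕ.+ (c ℕ.+ r) ≡ b ℕ.* r →
                a ∣ b ℕ.* r → (u , v) ↝ (addToHead k v , addToHead 1 u)

  -- Ensures that the `k` of `collision` is a natural number.
  collision-room : ∀ r → a ∣ b ℕ.* suc r → c ℕ.+ suc r ≤ b ℕ.* suc r
  -- A single surplus letter would give `a ∣ b`; from two on, `a < b` leaves enough room.
  collision-room zero    a∣b = contradiction (subst (a ∣_) (ℕ.*-identityʳ b) a∣b) a∤b
  collision-room (suc r) _   = subst₂ _≤_ (begin
    b ℕ.+ (suc a ℕ.+ r)  ≡⟨ regroup a b r ⟨
    a ℕ.+ b ℕ.+ suc r    ≡⟨ cong (ℕ._+ suc r) 1+c≡a+b ⟨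
    1 ℕ.+ c ℕ.+ suc r    ≡⟨ ℕ.+-suc c (suc r) ⟨
    c ℕ.+ (2 ℕ.+ r)      ∎)
    (expand b r) (ℕ.+-monoʳ-≤ b (ℕ.+-mono-≤ a<b (ℕ.m≤n*m r b)))
    where
    regroup : ∀ a b r → a ℕ.+ b ℕ.+ (1 ℕ.+ r) ≡ b ℕ.+ (1 ℕ.+ a ℕ.+ r)
    regroup = ℕ-solver.solve-∀
    expand : ∀ b r → b ℕ.+ (b ℕ.+ b ℕ.* r) ≡ b ℕ.* (2 ℕ.+ r)
    expand = ℕ-solver.solve-∀

  ↝-total : ∀ y → ∃ (y ↝_)
  ↝-total (u , v) with Vec.sum v ℕ.≤? Vec.sum u
  -- Equal sums belong here, with `r` and `k` both 0.
  ... | yes v≤u = let r , eq = ℕ.m≤n⇒∃[o]m+o≡n v≤u in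
    _ , a-excess r (a ℕ.* r ℕ.∸ r) (sym eq) (ℕ.m∸n+n≡m (ℕ.m≤n*m r a))
  ... | no v≰u with ℕ.m≤n⇒∃[o]m+o≡n (ℕ.≰⇒> v≰u)
  ... | r , eq with a ∣? b ℕ.* suc r
  ...   | yes a∣br = _ , collision (suc r) (b ℕ.* suc r ℕ.∸ (c ℕ.+ suc r))
                           (trans (sym eq) (sym (ℕ.+-suc _ r)))
                           (ℕ.m∸n+n≡m (collision-room r a∣br)) a∣br
  ...   | no  a∤br = _ , b-excess (suc r) (b ℕ.* suc r ℕ.∸ suc r)
                           (trans (sym eq) (sym (ℕ.+-suc _ r)))
                           (ℕ.m∸n+n≡m (ℕ.m≤n*m (suc r) b)) a∤br

  ↝-weight : ∀ {e : Fin (suc L) → ℕ} → e zero ≡ 0 → ∀ {y z} → y ↝ z →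
             pairWeight e 1 c z ≡ pairWeight e a b y
  ↝-weight {e} e₀≡0 (a-excess {u} {v} r k sum≡ k≡) = begin
    _ ≡⟨ cong₂ ℕ._+_ (weight-+-addToHead e₀≡0 1 k u) (weight-+ c e v) ⟩
    _ ≡⟨ balance a b r k (weight e u) (weight e v) 1+c≡a+b sum≡ k≡ ⟩
    _ ≡⟨ cong₂ ℕ._+_ (weight-+ a e u) (weight-+ b e v) ⟨
    _ ∎
  ↝-weight {e} e₀≡0 (b-excess {u} {v} r k sum≡ k≡ _) = begin
    _ ≡⟨ cong₂ ℕ._+_ (weight-+-addToHead e₀≡0 1 k v) (weight-+ c e u) ⟩
    _ ≡⟨ balance b a r k (weight e v) (weight e u) (trans 1+c≡a+b (ℕ.+-comm a b)) sum≡ k≡ ⟩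
    _ ≡⟨ cong₂ ℕ._+_ (weight-+ b e v) (weight-+ a e u) ⟨
    _ ≡⟨ ℕ.+-comm (weight (λ j → b ℕ.+ e j) v) _ ⟩
    _ ∎
  ↝-weight {e} e₀≡0 (collision {u} {v} r k sum≡ k≡ _) = begin
    _ ≡⟨ cong₂ ℕ._+_ (weight-+-addToHead e₀≡0 1 k v) (weight-+-addToHead e₀≡0 c 1 u) ⟩
    -- The extra letter `c` weighs as much as `c` letters 1, which reduces this to the `b-excess`
    -- balance with `k ℕ.+ c` for `k`.
    _ ≡⟨ transfer k c (Vec.sum u) (Vec.sum v) (weight e u) (weight e v) ⟩
    _ ≡⟨ balance b a r (k ℕ.+ c) (weight e v) (weight e u) (trans 1+c≡a+b (ℕ.+-comm a b)) sum≡
           (trans (ℕ.+-assoc k c r) k≡) ⟩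
    _ ≡⟨ cong₂ ℕ._+_ (weight-+ b e v) (weight-+ a e u) ⟨
    _ ≡⟨ ℕ.+-comm (weight (λ j → b ℕ.+ e j) v) _ ⟩
    _ ∎
    where
    transfer : ∀ k c s t E F →
      (1 ℕ.* (k ℕ.+ t) ℕ.+ F) ℕ.+ (c ℕ.* (1 ℕ.+ s) ℕ.+ E) ≡
      (1 ℕ.* (k ℕ.+ c ℕ.+ t) ℕ.+ F) ℕ.+ (c ℕ.* s ℕ.+ E)
    transfer = ℕ-solver.solve-∀

  -- A `collision` image has surplus `d′` less `a + b`, because one more letter `c` is present and
  -- `c` fewer letters 1; an excess image has surplus `d`.
  surplus-collision : ∀ {d d′ k k′ r r′} {u v u′ v′ : Vec ℕ (suc L)} →
    Vec.sum u ≡ Vec.sum v ℕ.+ r → Vec.sum u′ ≡ Vec.sum v′ ℕ.+ r′ →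
    k ℕ.+ r ≡ d → k′ ℕ.+ (c ℕ.+ r′) ≡ d′ →
    addToHead k u ≡ addToHead k′ u′ → v ≡ addToHead 1 v′ → d ℕ.+ (a ℕ.+ b) ≡ d′
  surplus-collision {d} {d′} {k} {k′} {r} {r′} {u} {v} {u′} {v′} sum≡ sum′≡ k≡ k′≡ eq refl =
    ℕ.+-cancelˡ-≡ (Vec.sum v′) _ _ (begin
      Vec.sum v′ ℕ.+ (d ℕ.+ (a ℕ.+ b))            ≡⟨ cong (λ s → Vec.sum v′ ℕ.+ (d ℕ.+ s)) 1+c≡a+b ⟨
      Vec.sum v′ ℕ.+ (d ℕ.+ (1 ℕ.+ c))            ≡⟨ regroup (Vec.sum v′) d c ⟩
      1 ℕ.+ Vec.sum v′ ℕ.+ d ℕ.+ c                ≡⟨ cong (λ s → s ℕ.+ d ℕ.+ c) (sum-addToHead 1 v′) ⟨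
      Vec.sum (addToHead 1 v′) ℕ.+ d ℕ.+ c        ≡⟨ cong (ℕ._+ c) (surplus₀ k r u sum≡ k≡) ⟨
      Vec.sum (addToHead k u) ℕ.+ c               ≡⟨ cong (λ w → Vec.sum w ℕ.+ c) eq ⟩
      Vec.sum (addToHead k′ u′) ℕ.+ c             ≡⟨ surplus c k′ r′ u′ sum′≡ k′≡ ⟩
      Vec.sum v′ ℕ.+ d′                           ∎)
    where
    regroup : ∀ s d c → s ℕ.+ (d ℕ.+ (1 ℕ.+ c)) ≡ 1 ℕ.+ s ℕ.+ d ℕ.+ c
    regroup = ℕ-solver.solve-∀

  a*r≢b*r′ : ∀ {r r′} → a ∤ b ℕ.* r′ → a ℕ.* r ≢ b ℕ.* r′
  a*r≢b*r′ {r} a∤br′ eq = a∤br′ (subst (a ∣_) eq (m∣m*n r))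

  -- Otherwise `a` would divide `a + b`, and so `b`.
  a*r+a+b≢b*r′ : ∀ {r r′} → a ∣ b ℕ.* r′ → a ℕ.* r ℕ.+ (a ℕ.+ b) ≢ b ℕ.* r′
  a*r+a+b≢b*r′ {r} a∣br′ eq =
    a∤b (∣m+n∣m⇒∣n (∣m+n∣m⇒∣n (subst (a ∣_) (sym eq) a∣br′) (m∣m*n r)) ∣-refl)

  -- Otherwise `b` would divide `a + b`, and so the smaller number `a`.
  b*r+a+b≢b*r′ : ∀ {r r′} → b ℕ.* r ℕ.+ (a ℕ.+ b) ≢ b ℕ.* r′
  b*r+a+b≢b*r′ {r} {r′} eq = ℕ.<⇒≱ a<b (∣⇒≤ (∣m+n∣m⇒∣n
    (subst (b ∣_) (ℕ.+-comm a b) (∣m+n∣m⇒∣n (subst (b ∣_) (sym eq) (m∣m*n r′)) (m∣m*n r))) ∣-refl))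

  -- Equal constructors are settled by cancellation; different ones would have equal surpluses,
  -- which divisibility excludes.
  ↝-injective : ∀ {y y′ z z′} → y ↝ z → y′ ↝ z′ → z ≡ z′ → y ≡ y′
  ↝-injective (a-excess _ _ s k) (a-excess _ _ s′ k′) eq = let eq₁ , eq₂ = ,-injective eq in
    cong₂ _,_ (addToHead-cancel a 0 s s′ k k′ eq₁ eq₂) eq₂
  ↝-injective (a-excess _ _ s k) (b-excess _ _ s′ k′ a∤) eq = let eq₁ , eq₂ = ,-injective eq in
    contradiction (surplus-unique s s′ k k′ eq₁ eq₂) (a*r≢b*r′ a∤)
  ↝-injective (a-excess _ _ s k) (collision _ _ s′ k′ a∣) eq = let eq₁ , eq₂ = ,-injective eq in
    contradiction (surplus-collision s s′ k k′ eq₁ eq₂) (a*r+a+b≢b*r′ a∣)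
  ↝-injective (b-excess _ _ s k _) (b-excess _ _ s′ k′ _) eq = let eq₁ , eq₂ = ,-injective eq in
    cong₂ _,_ eq₂ (addToHead-cancel b 0 s s′ k k′ eq₁ eq₂)
  ↝-injective (b-excess _ _ s k _) (collision _ _ s′ k′ _) eq = let eq₁ , eq₂ = ,-injective eq in
    contradiction (surplus-collision s s′ k k′ eq₁ eq₂) b*r+a+b≢b*r′
  ↝-injective (collision _ _ s k _) (collision _ _ s′ k′ _) eq =
    let eq₁ , eq₂ = ,-injective eq ; u≡u′ = addToHead-injective 1 eq₂ in
    cong₂ _,_ u≡u′ (addToHead-cancel b c s s′ k k′ eq₁ u≡u′)
  -- The other orders of the mixed cases follow by symmetry.
  ↝-injective y↝z@(b-excess _ _ _ _ _) y′↝z′@(a-excess _ _ _ _) eq =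
    sym (↝-injective y′↝z′ y↝z (sym eq))
  ↝-injective y↝z@(collision _ _ _ _ _) y′↝z′@(a-excess _ _ _ _) eq =
    sym (↝-injective y′↝z′ y↝z (sym eq))
  ↝-injective y↝z@(collision _ _ _ _ _) y′↝z′@(b-excess _ _ _ _ _) eq =
    sym (↝-injective y′↝z′ y↝z (sym eq))

-- Coefficientwise comparison of the two reciprocals.

theorem1p1 : (a b c M : ℕ) → 1 ≤ M → 1 < a → a < b → b < c → 1 ℕ.+ c ≡ a ℕ.+ b → a ∤ b →
    (L : ℕ) → (⦅ q ∷ q ^ c ∷ [] ⨾⨾ q ^ M ⦆ L) ⁻¹ - (⦅ q ^ a ∷ q ^ b ∷ [] ⨾⨾ q ^ M ⦆ L) ⁻¹ ⪰0
-- With no parts there is no position `j = 0` to receive letters, but both products are empty and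
-- the difference vanishes.
theorem1p1 a b c M _ 1<a a<b b<c 1+c≡a+b a∤b zero n =
  ℤ.≤-reflexive (sym (ℤ.+-inverseʳ (((1# * (1# * 1#)) ⁻¹) n)))
theorem1p1 a b c M _ 1<a a<b b<c 1+c≡a+b a∤b (suc L) =
  ⪰0-from-injection
    (counts-⦅⨾⨾⦆⁻¹ M (suc L) ℕ.z<s 0<c refl (q^-constantTerm c 0<c) q-monomial (q^-monomial c))
    (counts-⦅⨾⨾⦆⁻¹ M (suc L) 0<a 0<b (q^-constantTerm a 0<a) (q^-constantTerm b 0<b)
      (q^-monomial a) (q^-monomial b))
    (proj₁ ∘ total)
    -- `refl` states that the offset at `j = 0` is `0 * M`, that is 0.
    (λ y → ↝-weight 1<a a<b 1+c≡a+b a∤b refl (proj₂ (total y)))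
    (λ {y} {z} → ↝-injective 1<a a<b 1+c≡a+b a∤b (proj₂ (total y)) (proj₂ (total z)))
  where
  0<a = ℕ.<-trans ℕ.z<s 1<a
  0<b = ℕ.<-trans 0<a a<b
  0<c = ℕ.<-trans 0<b b<c
  total = ↝-total 1<a a<b 1+c≡a+b a∤b {L}
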